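{- There exist absolute constants $C>0$ and $c>0$ such that for every finite field $\mathbb{F}_q$ with $q$ elements, if $E\subset\mathbb{F}_q^3$ is in general position and $|E|\ge Cq^2$, then $$|vol(E)|\ge cq.$$
   Context: A set $E\subset\mathbb{F}_q^d$ is in general position if for every $n$ and every $n$-dimensional linear subspace $H_n\subset\mathbb{F}_q^d$ there exist $d-n$ linearly independent vectors of $E$ whose span does not intersect $H_n$ (i.e. meets $H_n$ only in the zero vector); here $d=3$. For $x^1,x^2,x^3\in\mathbb{F}_q^3$, $vol(x^1,x^2,x^3)$ is the determinant of the $3\times3$ matrix with rows $x^1,x^2,x^3$, and $vol(E)=\{vol(x^1,x^2,x^3): x^1,x^2,x^3\in E\}$. -}

module Defs where

open import Level using (Level) renaming (suc to lsuc)
open import Algebra.Bundles using (CommutativeRing)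
open import Algebra.Structures using (IsCommutativeRing)
open import Data.Fin.Base using (Fin)
import Data.Fin.Properties as Fin
open import Data.Integer.Base using (+_)
open import Data.List.Base using (List; cartesianProductWith; cartesianProduct; deduplicate)
open import Data.List.Membership.Propositional using (_∈_)
open import Data.Nat.Base using (ℕ; _∸_)
open import Data.Product.Base using (Σ; ∃; _×_; _,_)
open import Data.Rational.Base using (ℚ; _/_)
open import Data.Vec.Base as Vec using (Vec; []; _∷_; zipWith; replicate)
open import Data.Vec.Relation.Unary.All using (All)
open import Function.Bundles using (_↔_; _⇔_)
open import Function.Properties.Inverse using (↔⇒↣; ↔-sym)
open import Relation.Binary.Definitions using (DecidableEquality)
open import Relation.Binary.PropositionalEquality.Core using (_≡_; _≢_)
open import Relation.Nullary.Decidable using (via-injection)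
open import Relation.Unary using (Pred)


record FiniteField (a : Level) : Set (lsuc a) where
  infixl 6 _+_
  infixl 7 _*_
  infix  8 -_
  field
    Carrier           : Set a
    _+_ _*_           : Carrier → Carrier → Carrier
    -_                : Carrier → Carrier
    0# 1#             : Carrier
    isCommutativeRing : IsCommutativeRing _≡_ _+_ _*_ -_ 0# 1#
    1≢0               : 1# ≢ 0#
    inverse           : ∀ x → x ≢ 0# → ∃ λ y → x * y ≡ 1#
    order             : ℕ
    enumeration       : Fin order ↔ Carrier

  commutativeRing : CommutativeRing a a
  commutativeRing = record { isCommutativeRing = isCommutativeRing }

  open IsCommutativeRing isCommutativeRing public using (_-_)

  _≟_ : DecidableEquality Carrier
  _≟_ = via-injection (↔⇒↣ (↔-sym enumeration)) Fin._≟_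

module LinearAlgebra {a : Level} (F : FiniteField a) where
  open FiniteField F

  V : ℕ → Set a
  V d = Vec Carrier d

  infixl 6 _+ᵛ_
  infixr 7 _·ᵛ_

  0ᵛ : ∀ {d} → V d
  0ᵛ = replicate _ 0#

  _+ᵛ_ : ∀ {d} → V d → V d → V d
  _+ᵛ_ = zipWith _+_

  _·ᵛ_ : ∀ {d} → Carrier → V d → V d
  c ·ᵛ v = Vec.map (c *_) v

  combination : ∀ {d k} → Vec Carrier k → Vec (V d) k → V d
  combination []       []       = 0ᵛ
  combination (c ∷ cs) (v ∷ vs) = c ·ᵛ v +ᵛ combination cs vs

  Span : ∀ {d k} → Vec (V d) k → Pred (V d) a
  Span vs x = ∃ λ cs → combination cs vs ≡ x

  LinearlyIndependent : ∀ {d k} → Vec (V d) k → Set a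
  LinearlyIndependent vs = ∀ cs → combination cs vs ≡ 0ᵛ → cs ≡ 0ᵛ

  record IsSubspace {d : ℕ} (H : Pred (V d) a) : Set a where
    field
      0-closed : H 0ᵛ
      +-closed : ∀ {x y} → H x → H y → H (x +ᵛ y)
      ·-closed : ∀ c {x} → H x → H (c ·ᵛ x)

  HasDimension : ∀ {d} → Pred (V d) a → ℕ → Set a
  HasDimension {d} H n = Σ (Vec (V d) n) λ b →
    LinearlyIndependent b × (∀ x → H x ⇔ Span b x)

  -- A subspace of V d has dimension n ≤ d, so d ∸ n never truncates below.
  InGeneralPosition : ∀ {d} → List (V d) → Set (lsuc a)
  InGeneralPosition {d} E =
    ∀ (n : ℕ) (H : Pred (V d) a) → IsSubspace H → HasDimension H n →
    Σ (Vec (V d) (d ∸ n)) λ vs →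
      All (_∈ E) vs ×
      LinearlyIndependent vs ×
      (∀ x → Span vs x → H x → x ≡ 0ᵛ)

  -- The determinant of the 3 × 3 matrix with the given rows, expanded along
  -- the first row.
  vol : V 3 → V 3 → V 3 → Carrier
  vol (x₁ ∷ x₂ ∷ x₃ ∷ []) (y₁ ∷ y₂ ∷ y₃ ∷ []) (z₁ ∷ z₂ ∷ z₃ ∷ []) =
      x₁ * (y₂ * z₃ - y₃ * z₂)
    - x₂ * (y₁ * z₃ - y₃ * z₁)
    + x₃ * (y₁ * z₂ - y₂ * z₁)

  -- The set of all values vol x y z with x, y, z ∈ E (not necessarily
  -- distinct), listed without repetition, so its length is its cardinality.
  volSet : List (V 3) → List Carrier
  volSet E = deduplicate _≟_
    (cartesianProductWith (λ x (y , z) → vol x y z) E (cartesianProduct E E))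

fromℕ : ℕ → ℚ
fromℕ n = + n / 1

{-# OPTIONS --safe #-}

-- For f ∈ 𝔽_q³ and s ∈ 𝔽_q let N f s be the number of x ∈ E with x ∙ f = s, where E has been cut
-- down to exactly 3q² points. Two distinct points agree under x ↦ x ∙ f for at most q² of the q³
-- vectors f, so Σ_{f,s} (N f s)² ≤ 9q⁶ + 3q⁵: on average over f, the squared deviation
-- Σ_s (N f s − 3q)² from the mean 3q is at most 3q².
--
-- Suppose t is not a volume of E. Then for every f some N f s is at most q, so the squared deviation
-- is at least 4q², a contradiction. This is clear for f = 0, and for f ≠ 0 there are two cases. If
-- E ∩ f^⊥ contains y and z with y × z ≠ 0, then y × z = μ f with μ ≠ 0, and x ∙ f = t / μ would give
-- vol x y z = t, so N f (t / μ) = 0. Otherwise E ∩ f^⊥ lies on a line, and N f 0 ≤ q. Hence every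
-- element of 𝔽_q is a volume, that is C = 3 and c = 1.
module Submission where

open import Level using (Level)
open import Algebra.Bundles using (CommutativeRing)
open import Defs

-- The stock ring solvers take coefficients either in the ring itself, where an abstract 1 − 1 does
-- not reduce, or in ℕ; integer coefficients let terms cancel over an abstract commutative ring.
module IntegerCoefficients {c ℓ} (R : CommutativeRing c ℓ) where
  open import Algebra.Solver.Ring.AlmostCommutativeRing using (fromCommutativeRing; _-Raw-AlmostCommutative⟶_)
  open import Data.Integer.Base as ℤ using (ℤ; +_; -[1+_]; _⊖_)
  import Data.Integer.Properties as ℤ
  open import Data.Maybe.Base using (map)
  open import Data.Nat.Base as ℕ using (ℕ; zero; suc)
  import Relation.Binary.PropositionalEquality as ≡
  open import Relation.Nullary.Decidable using (dec⇒maybe)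
  open CommutativeRing R
  open import Algebra.Properties.Ring ring using (-0#≈0#; -‿distribˡ-*; -‿distribʳ-*; -‿+-comm; -‿involutive)
  open import Algebra.Properties.Semiring.Mult semiring using (_×_; ×-homo-+; ×1-homo-*)
  open import Relation.Binary.Reasoning.Setoid setoid

  fromℤ : ℤ → Carrier
  fromℤ (+ n)    = n × 1#
  fromℤ -[1+ n ] = - (suc n × 1#)

  private
    cancel-1 : ∀ x y → (1# + x) - (1# + y) ≈ x - y
    cancel-1 x y = begin
      (1# + x) - (1# + y)       ≈⟨ +-cong (+-comm 1# x) (sym (-‿+-comm 1# y)) ⟩
      (x + 1#) + (- 1# - y)     ≈⟨ +-assoc x 1# (- 1# - y) ⟩
      x + (1# + (- 1# - y))     ≈⟨ +-congˡ (+-assoc 1# (- 1#) (- y)) ⟨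
      x + ((1# - 1#) - y)       ≈⟨ +-congˡ (+-congʳ (-‿inverseʳ 1#)) ⟩
      x + (0# - y)              ≈⟨ +-congˡ (+-identityˡ (- y)) ⟩
      x - y                     ∎

  fromℤ-⊖ : ∀ m n → fromℤ (m ⊖ n) ≈ m × 1# - n × 1#
  fromℤ-⊖ zero    zero    = sym (-‿inverseʳ 0#)
  fromℤ-⊖ zero    (suc n) = sym (+-identityˡ _)
  fromℤ-⊖ (suc m) zero    = sym (trans (+-congˡ -0#≈0#) (+-identityʳ _))
  fromℤ-⊖ (suc m) (suc n) = begin
    fromℤ (suc m ⊖ suc n)        ≡⟨ ≡.cong fromℤ (ℤ.[1+m]⊖[1+n]≡m⊖n m n) ⟩
    fromℤ (m ⊖ n)                ≈⟨ fromℤ-⊖ m n ⟩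
    m × 1# - n × 1#              ≈⟨ cancel-1 (m × 1#) (n × 1#) ⟨
    suc m × 1# - suc n × 1#      ∎

  fromℤ-neg : ∀ i → fromℤ (ℤ.- i) ≈ - fromℤ i
  fromℤ-neg (+ zero)  = sym -0#≈0#
  fromℤ-neg (+ suc n) = refl
  fromℤ-neg -[1+ n ]  = sym (-‿involutive _)

  fromℤ-+ : ∀ i j → fromℤ (i ℤ.+ j) ≈ fromℤ i + fromℤ j
  fromℤ-+ (+ m)    (+ n)    = ×-homo-+ 1# m n
  fromℤ-+ (+ m)    -[1+ n ] = fromℤ-⊖ m (suc n)
  fromℤ-+ -[1+ m ] (+ n)    = trans (fromℤ-⊖ n (suc m)) (+-comm _ _)
  fromℤ-+ -[1+ m ] -[1+ n ] = begin
    fromℤ (-[1+ m ] ℤ.+ -[1+ n ])           ≡⟨ ≡.cong fromℤ (ℤ.neg-distrib-+ (+ suc m) (+ suc n)) ⟨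
    - ((suc m ℕ.+ suc n) × 1#)              ≈⟨ -‿cong (×-homo-+ 1# (suc m) (suc n)) ⟩
    - (suc m × 1# + suc n × 1#)             ≈⟨ -‿+-comm _ _ ⟨
    - (suc m × 1#) - suc n × 1#             ∎

  -- A nonnegative left factor comes first, so that `fromℤ-*` only has to pull one sign out of its
  -- left factor.
  fromℤ-pos-* : ∀ m j → fromℤ (+ m ℤ.* j) ≈ fromℤ (+ m) * fromℤ j
  fromℤ-pos-* m (+ n) = begin
    fromℤ (+ m ℤ.* + n)          ≡⟨ ≡.cong fromℤ (ℤ.pos-* m n) ⟨
    (m ℕ.* n) × 1#               ≈⟨ ×1-homo-* m n ⟩
    (m × 1#) * (n × 1#)          ∎
  fromℤ-pos-* m -[1+ n ] = begin
    fromℤ (+ m ℤ.* -[1+ n ])       ≡⟨ ≡.cong fromℤ (ℤ.neg-distribʳ-* (+ m) (+ suc n)) ⟨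
    fromℤ (ℤ.- (+ m ℤ.* + suc n))  ≈⟨ fromℤ-neg (+ m ℤ.* + suc n) ⟩
    - fromℤ (+ m ℤ.* + suc n)      ≡⟨ ≡.cong (λ i → - fromℤ i) (ℤ.pos-* m (suc n)) ⟨
    - ((m ℕ.* suc n) × 1#)         ≈⟨ -‿cong (×1-homo-* m (suc n)) ⟩
    - ((m × 1#) * (suc n × 1#))    ≈⟨ -‿distribʳ-* _ _ ⟩
    (m × 1#) * fromℤ -[1+ n ]      ∎

  fromℤ-* : ∀ i j → fromℤ (i ℤ.* j) ≈ fromℤ i * fromℤ j
  fromℤ-* (+ m)    j = fromℤ-pos-* m j
  fromℤ-* -[1+ m ] j = begin
    fromℤ (-[1+ m ] ℤ.* j)       ≡⟨ ≡.cong fromℤ (ℤ.neg-distribˡ-* (+ suc m) j) ⟨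
    fromℤ (ℤ.- (+ suc m ℤ.* j))  ≈⟨ fromℤ-neg (+ suc m ℤ.* j) ⟩
    - fromℤ (+ suc m ℤ.* j)      ≈⟨ -‿cong (fromℤ-pos-* (suc m) j) ⟩
    - ((suc m × 1#) * fromℤ j)   ≈⟨ -‿distribˡ-* _ _ ⟩
    fromℤ -[1+ m ] * fromℤ j     ∎

  homomorphism : ℤ.+-*-rawRing -Raw-AlmostCommutative⟶ fromCommutativeRing R
  homomorphism = record
    { ⟦_⟧    = fromℤ
    ; +-homo = fromℤ-+
    ; *-homo = fromℤ-*
    ; -‿homo = fromℤ-neg
    ; 0-homo = refl
    ; 1-homo = +-identityʳ 1#
    }

  open import Algebra.Solver.Ring ℤ.+-*-rawRing (fromCommutativeRing R) homomorphism
    (λ i j → map (λ i≡j → reflexive (≡.cong fromℤ i≡j)) (dec⇒maybe (i ℤ.≟ j))) public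

-- Finite sums, counting by indicators, and the variance inequality.

module Sums where
  open import Data.List.Base using (List; []; _∷_; length; _++_; map; cartesianProductWith)
  open import Data.List.Membership.Propositional using (_∈_)
  open import Data.List.Relation.Unary.All using ([]; _∷_; lookup)
  open import Data.List.Relation.Unary.AllPairs using ([]; _∷_)
  open import Data.List.Relation.Unary.Any using (here; there)
  open import Data.List.Relation.Unary.Unique.Propositional using (Unique)
  open import Data.Nat.Base using (ℕ; _+_; _*_; _≤_; z≤n; s≤s; ∣_-_∣)
  open import Data.Nat.Properties
  open import Data.Nat.Tactic.RingSolver using (solve-∀)
  open import Data.Product.Base using (_,_)
  open import Data.Sum.Base using (inj₁; inj₂)
  open import Relation.Binary.PropositionalEquality
  open import Relation.Nullary.Decidable using (Dec; yes; no)
  open import Relation.Nullary.Negation using (¬_; contradiction)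
  open import Relation.Unary using (Pred; Decidable)

  private variable
    a p : Level
    A B C P Q : Set a
    xs : List A

  ∑ : List A → (A → ℕ) → ℕ
  ∑ []       f = 0
  ∑ (x ∷ xs) f = f x + ∑ xs f

  infix 5 ∑
  syntax ∑ xs (λ x → e) = ∑[ x ← xs ] e

  -- The Iverson bracket: cardinalities become sums of brackets, and double counting becomes
  -- `∑-swap`.
  ⟦_⟧ : Dec P → ℕ
  ⟦ yes _ ⟧ = 1
  ⟦ no  _ ⟧ = 0

  ⟦⟧-mono : (P? : Dec P) (Q? : Dec Q) → (P → Q) → ⟦ P? ⟧ ≤ ⟦ Q? ⟧
  ⟦⟧-mono (no _)  _       f = z≤n
  ⟦⟧-mono (yes _) (yes _) f = ≤-refl
  ⟦⟧-mono (yes p) (no ¬q) f = contradiction (f p) ¬q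

  ⟦⟧-yes : (P? : Dec P) → P → 1 ≤ ⟦ P? ⟧
  ⟦⟧-yes (yes _) _ = ≤-refl
  ⟦⟧-yes (no ¬p) p = contradiction p ¬p

  ∑-mono : (xs : List A) {f g : A → ℕ} → (∀ {x} → x ∈ xs → f x ≤ g x) → ∑ xs f ≤ ∑ xs g
  ∑-mono []       f≤g = z≤n
  ∑-mono (x ∷ xs) f≤g = +-mono-≤ (f≤g (here refl)) (∑-mono xs (λ x∈xs → f≤g (there x∈xs)))

  ∑-cong : (xs : List A) {f g : A → ℕ} → (∀ x → f x ≡ g x) → ∑ xs f ≡ ∑ xs g
  ∑-cong []       f≡g = refl
  ∑-cong (x ∷ xs) f≡g = cong₂ _+_ (f≡g x) (∑-cong xs f≡g)

  ∑-const : (xs : List A) (k : ℕ) → (∑[ x ← xs ] k) ≡ length xs * k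
  ∑-const []       k = refl
  ∑-const (x ∷ xs) k = cong (k +_) (∑-const xs k)

  ∑-+ : (xs : List A) (f g : A → ℕ) → (∑[ x ← xs ] f x + g x) ≡ ∑ xs f + ∑ xs g
  ∑-+ []       f g = refl
  ∑-+ (x ∷ xs) f g = trans (cong (f x + g x +_) (∑-+ xs f g)) (interchange (f x) (g x) (∑ xs f) (∑ xs g))
    where
    interchange : ∀ p q r s → p + q + (r + s) ≡ p + r + (q + s)
    interchange = solve-∀

  ∑-*ˡ : (xs : List A) (k : ℕ) (f : A → ℕ) → (∑[ x ← xs ] k * f x) ≡ k * ∑ xs f
  ∑-*ˡ []       k f = sym (*-zeroʳ k)
  ∑-*ˡ (x ∷ xs) k f = trans (cong (k * f x +_) (∑-*ˡ xs k f)) (sym (*-distribˡ-+ k (f x) (∑ xs f)))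

  ∑-*ʳ : (xs : List A) (f : A → ℕ) (k : ℕ) → (∑[ x ← xs ] f x * k) ≡ ∑ xs f * k
  ∑-*ʳ xs f k = trans (∑-cong xs (λ x → *-comm (f x) k)) (trans (∑-*ˡ xs k f) (*-comm k (∑ xs f)))

  ∑-*-∑ : (xs : List A) (ys : List B) (f : A → ℕ) (g : B → ℕ) →
          ∑ xs f * ∑ ys g ≡ (∑[ x ← xs ] ∑[ y ← ys ] f x * g y)
  ∑-*-∑ xs ys f g = sym (trans (∑-cong xs (λ x → ∑-*ˡ ys (f x) g)) (∑-*ʳ xs f (∑ ys g)))

  ∑-swap : (xs : List A) (ys : List B) (f : A → B → ℕ) →
           (∑[ x ← xs ] ∑[ y ← ys ] f x y) ≡ (∑[ y ← ys ] ∑[ x ← xs ] f x y)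
  ∑-swap []       ys f = sym (trans (∑-const ys 0) (*-zeroʳ (length ys)))
  ∑-swap (x ∷ xs) ys f = trans (cong (∑ ys (f x) +_) (∑-swap xs ys f))
                               (sym (∑-+ ys (f x) (λ y → ∑[ x ← xs ] f x y)))

  ∑-++ : (xs ys : List A) (f : A → ℕ) → ∑ (xs ++ ys) f ≡ ∑ xs f + ∑ ys f
  ∑-++ []       ys f = refl
  ∑-++ (x ∷ xs) ys f = trans (cong (f x +_) (∑-++ xs ys f)) (sym (+-assoc (f x) _ _))

  ∑-map : (h : A → B) (xs : List A) (f : B → ℕ) → ∑ (map h xs) f ≡ (∑[ x ← xs ] f (h x))
  ∑-map h []       f = refl
  ∑-map h (x ∷ xs) f = cong (f (h x) +_) (∑-map h xs f)

  ∑-product : (h : A → B → C) (xs : List A) (ys : List B) (f : C → ℕ) →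
              ∑ (cartesianProductWith h xs ys) f ≡ (∑[ x ← xs ] ∑[ y ← ys ] f (h x y))
  ∑-product h []       ys f = refl
  ∑-product h (x ∷ xs) ys f = trans (∑-++ (map (h x) ys) _ f)
    (cong₂ _+_ (∑-map (h x) ys f) (∑-product h xs ys f))

  term≤∑ : (f : A → ℕ) {x : A} → x ∈ xs → f x ≤ ∑ xs f
  term≤∑ f (here refl)  = m≤m+n _ _
  term≤∑ f (there x∈xs) = ≤-trans (term≤∑ f x∈xs) (m≤n+m _ _)

  module _ {P : Pred A p} (P? : Decidable P) where

    count≤0 : (xs : List A) → (∀ {x} → x ∈ xs → ¬ P x) → (∑[ x ← xs ] ⟦ P? x ⟧) ≤ 0
    count≤0 []       ¬P = z≤n
    count≤0 (x ∷ xs) ¬P with P? x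
    ... | yes p = contradiction p (¬P (here refl))
    ... | no  _ = count≤0 xs (λ x∈xs → ¬P (there x∈xs))

    -- After a first hit, any later hit would equal it, contradicting the absence of duplicates.
    count≤1 : Unique xs → (∀ {x y} → P x → P y → x ≡ y) → (∑[ x ← xs ] ⟦ P? x ⟧) ≤ 1
    count≤1 []                           P-unique = z≤n
    count≤1 {xs = x ∷ xs} (x∉xs ∷ xs!) P-unique with P? x
    ... | no  _ = count≤1 xs! P-unique
    ... | yes p = s≤s (count≤0 xs (λ y∈xs q → lookup x∉xs y∈xs (P-unique p q)))

  -- The expansion of (m - n)², with the negative term moved across to stay in ℕ. The absolute
  -- difference depends on which argument is larger, hence the two cases.
  square-deviation : ∀ m n → m * m + n * n ≡ 2 * n * m + ∣ m - n ∣ * ∣ m - n ∣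
  square-deviation m n with ≤-total m n
  ... | inj₁ m≤n with k , refl ← m≤n⇒∃[o]m+o≡n m≤n rewrite ∣m-m+n∣≡n m k = identity m k
    where
    identity : ∀ m k → m * m + (m + k) * (m + k) ≡ 2 * (m + k) * m + k * k
    identity = solve-∀
  ... | inj₂ n≤m with k , refl ← m≤n⇒∃[o]m+o≡n n≤m rewrite ∣-∣-comm (n + k) n | ∣m-m+n∣≡n n k = identity n k
    where
    identity : ∀ n k → (n + k) * (n + k) + n * n ≡ 2 * n * (n + k) + k * k
    identity = solve-∀

  -- The variance identity about an arbitrary centre μ, keeping a single deviation.
  second-moment-bound : (xs : List A) (f : A → ℕ) (μ δ : ℕ) {x : A} → x ∈ xs → δ ≤ ∣ f x - μ ∣ →
    2 * μ * ∑ xs f + δ * δ ≤ (∑[ x ← xs ] f x * f x) + length xs * (μ * μ)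
  second-moment-bound xs f μ δ {x} x∈xs δ≤ = begin
    2 * μ * ∑ xs f + δ * δ
      ≤⟨ +-monoʳ-≤ (2 * μ * ∑ xs f) (≤-trans (*-mono-≤ δ≤ δ≤) (term≤∑ D x∈xs)) ⟩
    2 * μ * ∑ xs f + ∑ xs D
      ≡⟨ cong (_+ ∑ xs D) (∑-*ˡ xs (2 * μ) f) ⟨
    (∑[ x ← xs ] 2 * μ * f x) + ∑ xs D
      ≡⟨ ∑-+ xs (λ x → 2 * μ * f x) D ⟨
    (∑[ x ← xs ] 2 * μ * f x + D x)
      ≡⟨ ∑-cong xs (λ x → square-deviation (f x) μ) ⟨
    (∑[ x ← xs ] f x * f x + μ * μ)
      ≡⟨ ∑-+ xs (λ x → f x * f x) (λ _ → μ * μ) ⟩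
    (∑[ x ← xs ] f x * f x) + (∑[ x ← xs ] μ * μ)
      ≡⟨ cong ((∑[ x ← xs ] f x * f x) +_) (∑-const xs (μ * μ)) ⟩
    (∑[ x ← xs ] f x * f x) + length xs * (μ * μ) ∎
    where
    open ≤-Reasoning
    D : _ → ℕ
    D x = ∣ f x - μ ∣ * ∣ f x - μ ∣

-- Dot products, cross products and parallel vectors.

module Vectors {a : Level} (F : FiniteField a) where
  open import Algebra.Structures using (IsCommutativeRing)
  open import Data.Fin.Patterns using (0F; 1F; 2F)
  open import Data.Fin.Properties using (¬∀⟶∃¬)
  open import Data.Integer.Base using (0ℤ)
  open import Data.Product.Base using (∃; _,_)
  open import Data.Vec.Base using (Vec; []; _∷_; lookup)
  open import Data.Vec.Properties using (lookup-map; lookup-replicate; ≡-dec)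
  open import Data.Vec.Relation.Binary.Equality.Propositional using (≋⇒≡)
  open import Data.Vec.Relation.Binary.Pointwise.Extensional using (ext; extensional⇒inductive)
  open import Relation.Binary.Definitions using (DecidableEquality)
  open import Relation.Binary.PropositionalEquality
  open FiniteField F
  open LinearAlgebra F
  open IsCommutativeRing isCommutativeRing using (+-identityʳ; *-comm; *-assoc; *-identityʳ; zeroˡ; zeroʳ)
  open import Algebra.Properties.Group (CommutativeRing.+-group commutativeRing) using (x∙y⁻¹≈ε⇒x≈y; x≈y⇒x∙y⁻¹≈ε)
  open IntegerCoefficients commutativeRing using (Polynomial; con; solve; _:=_; _:+_; _:*_; _:-_)
  open ≡-Reasoning

  infix 4 _≟ᵛ_
  _≟ᵛ_ : ∀ {d} → DecidableEquality (V d)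
  _≟ᵛ_ = ≡-dec _≟_

  infix 8 _∙_
  _∙_ : ∀ {d} → V d → V d → Carrier
  []       ∙ []       = 0#
  (x ∷ xs) ∙ (y ∷ ys) = x * y + xs ∙ ys

  cross : V 3 → V 3 → V 3
  cross (y₁ ∷ y₂ ∷ y₃ ∷ []) (z₁ ∷ z₂ ∷ z₃ ∷ []) =
    (y₂ * z₃ + - (y₃ * z₂)) ∷ (y₃ * z₁ + - (y₁ * z₃)) ∷ (y₁ * z₂ + - (y₂ * z₁)) ∷ []

  private
    infixl 10 _:∙_
    -- The trailing `con 0ℤ` mirrors the `0#` that ends every `_∙_`, so that evaluated polynomials
    -- agree with dot products by computation.
    _:∙_ : ∀ {n} → Vec (Polynomial n) 3 → Vec (Polynomial n) 3 → Polynomial n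
    (x₁ ∷ x₂ ∷ x₃ ∷ []) :∙ (y₁ ∷ y₂ ∷ y₃ ∷ []) = x₁ :* y₁ :+ (x₂ :* y₂ :+ (x₃ :* y₃ :+ con 0ℤ))

  -- For fixed `y` and `z` this exhibits the volume as a linear functional of `x`, with normal
  -- vector `cross y z`.
  vol≡∙-cross : ∀ x y z → vol x y z ≡ x ∙ cross y z
  vol≡∙-cross (x₁ ∷ x₂ ∷ x₃ ∷ []) (y₁ ∷ y₂ ∷ y₃ ∷ []) (z₁ ∷ z₂ ∷ z₃ ∷ []) =
    solve 9 (λ x₁ x₂ x₃ y₁ y₂ y₃ z₁ z₂ z₃ →
      x₁ :* (y₂ :* z₃ :- y₃ :* z₂) :- x₂ :* (y₁ :* z₃ :- y₃ :* z₁) :+ x₃ :* (y₁ :* z₂ :- y₂ :* z₁) :=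
      (x₁ ∷ x₂ ∷ x₃ ∷ []) :∙ ((y₂ :* z₃ :- y₃ :* z₂) ∷ (y₃ :* z₁ :- y₁ :* z₃) ∷ (y₁ :* z₂ :- y₂ :* z₁) ∷ []))
      refl x₁ x₂ x₃ y₁ y₂ y₃ z₁ z₂ z₃

  ∙-zeroʳ : ∀ {d} (x : V d) → x ∙ 0ᵛ ≡ 0#
  ∙-zeroʳ []       = refl
  ∙-zeroʳ (x ∷ xs) = trans (cong₂ _+_ (zeroʳ x) (∙-zeroʳ xs)) (+-identityʳ 0#)

  ∙-·ᵛ : ∀ {d} (x : V d) c y → x ∙ (c ·ᵛ y) ≡ c * x ∙ y
  ∙-·ᵛ []       c []       = sym (zeroʳ c)
  ∙-·ᵛ (x ∷ xs) c (y ∷ ys) = trans (cong (x * (c * y) +_) (∙-·ᵛ xs c ys)) 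
    (solve 4 (λ x c y s → x :* (c :* y) :+ c :* s := c :* (x :* y :+ s)) refl x c y (xs ∙ ys))

  quotient : ∀ t {u} → u ≢ 0# → ∃ λ s → u * s ≡ t
  quotient t {u} u≢0 with v , uv≡1 ← inverse u u≢0 = v * t , (begin
    u * (v * t) ≡⟨ *-assoc u v t ⟨
    u * v * t   ≡⟨ *-comm (u * v) t ⟩
    t * (u * v) ≡⟨ cong (t *_) uv≡1 ⟩
    t * 1#      ≡⟨ *-identityʳ t ⟩
    t           ∎)

  *-cancel-0 : ∀ {u v} → u ≢ 0# → u * v ≡ 0# → v ≡ 0#
  *-cancel-0 {u} {v} u≢0 uv≡0 with w , uw≡1 ← inverse u u≢0 = begin
    v           ≡⟨ *-identityʳ v ⟨
    v * 1#      ≡⟨ cong (v *_) uw≡1 ⟨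
    v * (u * w) ≡⟨ solve 3 (λ u v w → v :* (u :* w) := u :* v :* w) refl u v w ⟩
    u * v * w   ≡⟨ cong (_* w) uv≡0 ⟩
    0# * w      ≡⟨ zeroˡ w ⟩
    0#          ∎
  -- Subtracting the two equations cancels `A`, `B` and `s` and leaves (x - y)(c - c′) = 0.
  affine-agreement-unique : ∀ {x y} → x ≢ y → ∀ {A B s c c′} →
    A + (x * c + s) ≡ B + (y * c + s) → A + (x * c′ + s) ≡ B + (y * c′ + s) → c ≡ c′
  affine-agreement-unique {x} {y} x≢y {A} {B} {s} {c} {c′} eq eq′ =
    x∙y⁻¹≈ε⇒x≈y c c′ (*-cancel-0 (λ x-y≡0 → x≢y (x∙y⁻¹≈ε⇒x≈y x y x-y≡0)) (begin
      (x + - y) * (c + - c′)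
        ≡⟨ solve 7 (λ x y c c′ A B s → (x :- y) :* (c :- c′) :=
             (A :+ (x :* c :+ s) :- (B :+ (y :* c :+ s))) :- (A :+ (x :* c′ :+ s) :- (B :+ (y :* c′ :+ s))))
             refl x y c c′ A B s ⟩
      (A + (x * c + s) + - (B + (y * c + s))) + - (A + (x * c′ + s) + - (B + (y * c′ + s)))
        ≡⟨ cong₂ (λ u v → u + - v) (x≈y⇒x∙y⁻¹≈ε eq) (x≈y⇒x∙y⁻¹≈ε eq′) ⟩
      0# + - 0#
        ≡⟨ x≈y⇒x∙y⁻¹≈ε refl ⟩
      0# ∎))

  -- The vanishing of all 2 × 2 minors: a polynomial form of proportionality that singles out no
  -- scalar and treats zero vectors uniformly.
  Parallel : ∀ {d} → V d → V d → Set a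
  Parallel x y = ∀ i j → lookup x i * lookup y j ≡ lookup x j * lookup y i

  lookup-ext : ∀ {d} {x y : V d} → (∀ i → lookup x i ≡ lookup y i) → x ≡ y
  lookup-ext eq = ≋⇒≡ (extensional⇒inductive (ext eq))

  nonzero-coordinate : ∀ {d} {x : V d} → x ≢ 0ᵛ → ∃ λ i → lookup x i ≢ 0#
  nonzero-coordinate {d} {x} x≢0 = ¬∀⟶∃¬ d (λ i → lookup x i ≡ 0#) (λ i → lookup x i ≟ 0#)
    (λ eq → x≢0 (lookup-ext (λ i → trans (eq i) (sym (lookup-replicate i 0#)))))

  -- A nonzero coordinate `i` of `x` serves as pivot: it fixes the scalar as the quotient of the
  -- `i`-th coordinates, and the minors through `i` determine every other coordinate of `y`.
  parallel⇒multiple : ∀ {d} {x y : V d} → x ≢ 0ᵛ → Parallel x y → ∃ λ c → y ≡ c ·ᵛ x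
  parallel⇒multiple {x = x} {y} x≢0 x∥y
    with i , xᵢ≢0 ← nonzero-coordinate x≢0
    with c , xᵢc≡yᵢ ← quotient (lookup y i) xᵢ≢0
    = c , lookup-ext λ j → begin
      lookup y j          ≡⟨ proportion j ⟩
      c * lookup x j      ≡⟨ lookup-map j (c *_) x ⟨
      lookup (c ·ᵛ x) j   ∎
    where
    proportion : ∀ j → lookup y j ≡ c * lookup x j
    proportion j = x∙y⁻¹≈ε⇒x≈y _ _ (*-cancel-0 xᵢ≢0 (begin
      lookup x i * (lookup y j + - (c * lookup x j))
        ≡⟨ solve 4 (λ xᵢ yⱼ c xⱼ → xᵢ :* (yⱼ :- c :* xⱼ) := xᵢ :* yⱼ :- xⱼ :* (xᵢ :* c))
             refl (lookup x i) (lookup y j) c (lookup x j) ⟩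
      lookup x i * lookup y j + - (lookup x j * (lookup x i * c))
        ≡⟨ cong (λ u → lookup x i * lookup y j + - (lookup x j * u)) xᵢc≡yᵢ ⟩
      lookup x i * lookup y j + - (lookup x j * lookup y i)
        ≡⟨ x≈y⇒x∙y⁻¹≈ε (x∥y i j) ⟩
      0# ∎))
  -- The coordinates of the cross product are the three minors with distinct indices, up to sign;
  -- the remaining cases are trivial or follow by symmetry.
  cross≡0⇒parallel : ∀ y z → cross y z ≡ 0ᵛ → Parallel y z
  cross≡0⇒parallel (y₁ ∷ y₂ ∷ y₃ ∷ []) (z₁ ∷ z₂ ∷ z₃ ∷ []) eq = λ where
      0F 0F → refl
      0F 1F → e₃
      0F 2F → sym e₂
      1F 0F → sym e₃
      1F 1F → refl
      1F 2F → e₁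
      2F 0F → e₂
      2F 1F → sym e₁
      2F 2F → refl
    where
    e₁ : y₂ * z₃ ≡ y₃ * z₂
    e₁ = x∙y⁻¹≈ε⇒x≈y _ _ (cong (λ v → lookup v 0F) eq)
    e₂ : y₃ * z₁ ≡ y₁ * z₃
    e₂ = x∙y⁻¹≈ε⇒x≈y _ _ (cong (λ v → lookup v 1F) eq)
    e₃ : y₁ * z₂ ≡ y₂ * z₁
    e₃ = x∙y⁻¹≈ε⇒x≈y _ _ (cong (λ v → lookup v 2F) eq)

  -- Lagrange's identity f × (y × z) = y (z ∙ f) - z (y ∙ f), checked in each coordinate by `i₁`,
  -- `i₂`, `i₃`; both dot products vanish.
  triple-product : ∀ f y z → y ∙ f ≡ 0# → z ∙ f ≡ 0# → cross f (cross y z) ≡ 0ᵛ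
  triple-product f@(f₁ ∷ f₂ ∷ f₃ ∷ []) y@(y₁ ∷ y₂ ∷ y₃ ∷ []) z@(z₁ ∷ z₂ ∷ z₃ ∷ []) yf≡0 zf≡0 =
    cong₂ _∷_ (trans (i₁ f₁ f₂ f₃ y₁ y₂ y₃ z₁ z₂ z₃) (vanish y₁ z₁))
    (cong₂ _∷_ (trans (i₂ f₁ f₂ f₃ y₁ y₂ y₃ z₁ z₂ z₃) (vanish y₂ z₂))
    (cong (_∷ []) (trans (i₃ f₁ f₂ f₃ y₁ y₂ y₃ z₁ z₂ z₃) (vanish y₃ z₃))))
    where
    vanish : ∀ u v → u * z ∙ f + - (v * y ∙ f) ≡ 0#
    vanish u v = begin
      u * z ∙ f + - (v * y ∙ f) ≡⟨ cong₂ (λ s t → u * s + - (v * t)) zf≡0 yf≡0 ⟩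
      u * 0# + - (v * 0#)       ≡⟨ cong₂ (λ s t → s + - t) (zeroʳ u) (zeroʳ v) ⟩
      0# + - 0#                 ≡⟨ x≈y⇒x∙y⁻¹≈ε refl ⟩
      0#                        ∎
    i₁ = solve 9 (λ f₁ f₂ f₃ y₁ y₂ y₃ z₁ z₂ z₃ →
      f₂ :* (y₁ :* z₂ :- y₂ :* z₁) :- f₃ :* (y₃ :* z₁ :- y₁ :* z₃) :=
      y₁ :* ((z₁ ∷ z₂ ∷ z₃ ∷ []) :∙ (f₁ ∷ f₂ ∷ f₃ ∷ [])) :-
      z₁ :* ((y₁ ∷ y₂ ∷ y₃ ∷ []) :∙ (f₁ ∷ f₂ ∷ f₃ ∷ []))) refl
    i₂ = solve 9 (λ f₁ f₂ f₃ y₁ y₂ y₃ z₁ z₂ z₃ →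
      f₃ :* (y₂ :* z₃ :- y₃ :* z₂) :- f₁ :* (y₁ :* z₂ :- y₂ :* z₁) :=
      y₂ :* ((z₁ ∷ z₂ ∷ z₃ ∷ []) :∙ (f₁ ∷ f₂ ∷ f₃ ∷ [])) :-
      z₂ :* ((y₁ ∷ y₂ ∷ y₃ ∷ []) :∙ (f₁ ∷ f₂ ∷ f₃ ∷ []))) refl
    i₃ = solve 9 (λ f₁ f₂ f₃ y₁ y₂ y₃ z₁ z₂ z₃ →
      f₁ :* (y₃ :* z₁ :- y₁ :* z₃) :- f₂ :* (y₂ :* z₃ :- y₃ :* z₂) :=
      y₃ :* ((z₁ ∷ z₂ ∷ z₃ ∷ []) :∙ (f₁ ∷ f₂ ∷ f₃ ∷ [])) :-
      z₃ :* ((y₁ ∷ y₂ ∷ y₃ ∷ []) :∙ (f₁ ∷ f₂ ∷ f₃ ∷ []))) refl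

  -- The scalar may still be 0; it is nonzero as soon as `cross y z` is.
  cross-normal : ∀ {f} y z → f ≢ 0ᵛ → y ∙ f ≡ 0# → z ∙ f ≡ 0# → ∃ λ μ → cross y z ≡ μ ·ᵛ f
  cross-normal {f} y z f≢0 yf≡0 zf≡0 =
    parallel⇒multiple f≢0 (cross≡0⇒parallel f (cross y z) (triple-product f y z yf≡0 zf≡0))

  0·ᵛ : ∀ {d} (x : V d) → 0# ·ᵛ x ≡ 0ᵛ
  0·ᵛ []       = refl
  0·ᵛ (x ∷ xs) = cong₂ _∷_ (zeroˡ x) (0·ᵛ xs)

-- Counting points of a set on the level sets of linear functionals.

module Counting {a : Level} (F : FiniteField a) where
  open import Algebra.Structures using (IsCommutativeRing)
  open import Data.List.Base using (List; []; _∷_; length; map; allFin; take; cartesianProductWith)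
  open import Data.List.Membership.Propositional using (_∈_; find; lose)
  open import Data.List.Membership.Propositional.Properties using (∈-map⁺; ∈-allFin; ∈-deduplicate⁺; ∈-cartesianProduct⁺; ∈-cartesianProductWith⁺)
  open import Data.List.Properties using (length-map; length-tabulate; length-take)
  open import Data.List.Relation.Unary.Any using (any?)
  open import Data.List.Relation.Unary.Unique.Propositional using (Unique)
  open import Data.List.Relation.Unary.Unique.Propositional.Properties using (map⁺; allFin⁺; take⁺)
  open import Data.List.Relation.Binary.Sublist.Propositional.Properties using (take-⊆)
  open import Data.Nat.Base
  open import Data.Nat.Properties hiding (_≟_)
  open import Data.Nat.Solver using (module +-*-Solver)
  open import Data.Product.Base using (∃; _×_; _,_; proj₁; proj₂)
  open import Data.Sum.Base using (_⊎_; inj₁; inj₂)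
  open import Data.Vec.Base using ([]; _∷_)
  import Data.List.Membership.DecPropositional as DecMembership
  import Data.List.Relation.Binary.Sublist.Propositional as Sublist
  open import Function.Bundles using (Inverse; Injection)
  open import Function.Properties.Inverse using (↔⇒↣)
  open import Relation.Binary.PropositionalEquality
  open import Relation.Nullary.Decidable using (yes; no; _×-dec_; ¬?; decidable-stable)
  open import Relation.Nullary.Negation using (¬_; contradiction)
  open +-*-Solver using (solve; _:=_; con; _:+_; _:*_; _:^_)
  open Sums
  open Vectors F
  open FiniteField F using (Carrier; 0#; 1#; 1≢0; order; enumeration; isCommutativeRing)
    renaming (_+_ to infixl 6 _+ᶠ_; _*_ to infixl 7 _*ᶠ_; _≟_ to infix 4 _≟_)
  open LinearAlgebra F
  open IsCommutativeRing isCommutativeRing using () renaming (+-assoc to +ᶠ-assoc)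

  -- Here `y` and `z` span the plane normal to `f`, so `x ↦ vol x y z` is a nonzero multiple of
  -- `x ↦ x ∙ f`, and a value missed by the one yields a value missed by the other.
  missing-volume⇒empty-level : ∀ {E t} →
    (∀ {x y z} → x ∈ E → y ∈ E → z ∈ E → vol x y z ≢ t) →
    ∀ {f y z} → f ≢ 0ᵛ → y ∈ E → z ∈ E → y ∙ f ≡ 0# → z ∙ f ≡ 0# → cross y z ≢ 0ᵛ →
    ∃ λ s → ∀ {x} → x ∈ E → x ∙ f ≢ s
  missing-volume⇒empty-level {E} {t} t-missing {f} {y} {z} f≢0 y∈E z∈E yf≡0 zf≡0 y×z≢0 =
    rescale (cross-normal y z f≢0 yf≡0 zf≡0)
    where
    rescale : (∃ λ μ → cross y z ≡ μ ·ᵛ f) → ∃ λ s → ∀ {x} → x ∈ E → x ∙ f ≢ s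
    rescale (μ , y×z≡μf) = proj₁ t/μ , λ {x} x∈E xf≡s → t-missing x∈E y∈E z∈E (begin
      vol x y z        ≡⟨ vol≡∙-cross x y z ⟩
      x ∙ cross y z    ≡⟨ cong (x ∙_) y×z≡μf ⟩
      x ∙ (μ ·ᵛ f)     ≡⟨ ∙-·ᵛ x μ f ⟩
      μ *ᶠ x ∙ f       ≡⟨ cong (μ *ᶠ_) xf≡s ⟩
      μ *ᶠ proj₁ t/μ   ≡⟨ proj₂ t/μ ⟩
      t                ∎)
      where
      open ≡-Reasoning
      μ≢0 : μ ≢ 0#
      μ≢0 μ≡0 = y×z≢0 (trans y×z≡μf (trans (cong (_·ᵛ f) μ≡0) (0·ᵛ f)))
      t/μ : ∃ λ s → μ *ᶠ s ≡ t
      t/μ = quotient t μ≢0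

  open ≤-Reasoning

  private
    q = order

  𝔽 : List Carrier
  𝔽 = map (Inverse.to enumeration) (allFin q)

  𝔽-unique : Unique 𝔽
  𝔽-unique = map⁺ (Injection.injective (↔⇒↣ enumeration)) (allFin⁺ q)

  ∈-𝔽 : ∀ c → c ∈ 𝔽
  ∈-𝔽 c = subst (_∈ 𝔽) (Inverse.strictlyInverseˡ enumeration c) (∈-map⁺ _ (∈-allFin _))

  length-𝔽 : length 𝔽 ≡ q
  length-𝔽 = trans (length-map _ (allFin q)) (length-tabulate {n = q} (λ i → i))

  ∑𝔽-const : ∀ k → (∑[ c ← 𝔽 ] k) ≡ q * k
  ∑𝔽-const k = trans (∑-const 𝔽 k) (cong (_* k) length-𝔽)

  1≤q : 1 ≤ q
  1≤q = begin
    1                  ≤⟨ term≤∑ (λ _ → 1) (∈-𝔽 0#) ⟩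
    (∑[ c ← 𝔽 ] 1)     ≡⟨ ∑𝔽-const 1 ⟩
    q * 1              ≡⟨ *-identityʳ q ⟩
    q                  ∎

  ∑-≡≤1 : ∀ x → (∑[ c ← 𝔽 ] ⟦ x ≟ c ⟧) ≤ 1
  ∑-≡≤1 x = count≤1 (x ≟_) 𝔽-unique (λ x≡y x≡z → trans (sym x≡y) x≡z)

  1≤∑-≡ : ∀ x → 1 ≤ (∑[ c ← 𝔽 ] ⟦ x ≟ c ⟧)
  1≤∑-≡ x = ≤-trans (⟦⟧-yes (x ≟ x) refl) (term≤∑ (λ c → ⟦ x ≟ c ⟧) (∈-𝔽 x))

  -- Distinct values share no level, and equal values share exactly one.
  ∑-common : ∀ x y → (∑[ c ← 𝔽 ] ⟦ x ≟ c ⟧ * ⟦ y ≟ c ⟧) ≤ ⟦ x ≟ y ⟧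
  ∑-common x y = ≤-trans (∑-mono 𝔽 (λ {c} _ → pointwise c)) (begin
      (∑[ c ← 𝔽 ] ⟦ x ≟ y ⟧ * ⟦ x ≟ c ⟧)  ≡⟨ ∑-*ˡ 𝔽 ⟦ x ≟ y ⟧ (λ c → ⟦ x ≟ c ⟧) ⟩
      ⟦ x ≟ y ⟧ * (∑[ c ← 𝔽 ] ⟦ x ≟ c ⟧)  ≤⟨ *-monoʳ-≤ ⟦ x ≟ y ⟧ (∑-≡≤1 x) ⟩
      ⟦ x ≟ y ⟧ * 1                        ≡⟨ *-identityʳ _ ⟩
      ⟦ x ≟ y ⟧                            ∎)
    where
    pointwise : ∀ c → ⟦ x ≟ c ⟧ * ⟦ y ≟ c ⟧ ≤ ⟦ x ≟ y ⟧ * ⟦ x ≟ c ⟧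
    pointwise c with x ≟ c | y ≟ c
    ... | no _    | _       = z≤n
    ... | yes _   | no _    = z≤n
    ... | yes x≡c | yes y≡c = ≤-trans (⟦⟧-yes (x ≟ y) (trans x≡c (sym y≡c))) (≤-reflexive (sym (*-identityʳ _)))

  -- The outer loop runs over the first coordinate, so that inductions on `d` can peel it off a sum.
  vectors : ∀ d → List (V d)
  vectors zero    = [] ∷ []
  vectors (suc d) = cartesianProductWith _∷_ 𝔽 (vectors d)

  ∑-vectors : ∀ d (f : V (suc d) → ℕ) → ∑ (vectors (suc d)) f ≡ (∑[ c ← 𝔽 ] ∑[ cs ← vectors d ] f (c ∷ cs))
  ∑-vectors d f = ∑-product _∷_ 𝔽 (vectors d) f

  ∑-vectors-const : ∀ d k → (∑[ v ← vectors d ] k) ≡ q ^ d * k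
  ∑-vectors-const zero    k = refl
  ∑-vectors-const (suc d) k = begin-equality
    (∑[ v ← vectors (suc d) ] k)             ≡⟨ ∑-vectors d (λ _ → k) ⟩
    (∑[ c ← 𝔽 ] ∑[ cs ← vectors d ] k)       ≡⟨ ∑𝔽-const _ ⟩
    q * (∑[ cs ← vectors d ] k)              ≡⟨ cong (q *_) (∑-vectors-const d k) ⟩
    q * (q ^ d * k)                          ≡⟨ *-assoc q (q ^ d) k ⟨
    q ^ suc d * k                            ∎

  -- The agreements solve a nontrivial affine equation in `f`, so they fill at most a hyperplane.
  -- The offsets `A` and `B` make the induction go through: when the tails differ, they absorb the
  -- contribution of the first coordinate.
  affine-agreements : ∀ d {x y : V (suc d)} → x ≢ y → ∀ A B →
    (∑[ f ← vectors (suc d) ] ⟦ A +ᶠ x ∙ f ≟ B +ᶠ y ∙ f ⟧) ≤ q ^ d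
  affine-agreements d {x ∷ xs} {y ∷ ys} x≢y A B with xs ≟ᵛ ys
  ... | yes refl = begin
    (∑[ f ← vectors (suc d) ] ⟦ A +ᶠ (x ∷ xs) ∙ f ≟ B +ᶠ (y ∷ xs) ∙ f ⟧)
      ≡⟨ ∑-vectors d _ ⟩
    (∑[ c ← 𝔽 ] ∑[ cs ← vectors d ] ⟦ A +ᶠ (x *ᶠ c +ᶠ xs ∙ cs) ≟ B +ᶠ (y *ᶠ c +ᶠ xs ∙ cs) ⟧)
      -- With equal tails the heads differ, so each choice of the other coordinates of `f` leaves at
      -- most one first coordinate; that sum has to be the inner one.
      ≡⟨ ∑-swap 𝔽 (vectors d) _ ⟩
    (∑[ cs ← vectors d ] ∑[ c ← 𝔽 ] ⟦ A +ᶠ (x *ᶠ c +ᶠ xs ∙ cs) ≟ B +ᶠ (y *ᶠ c +ᶠ xs ∙ cs) ⟧)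
      ≤⟨ ∑-mono (vectors d) (λ {cs} _ → count≤1 (λ c → A +ᶠ (x *ᶠ c +ᶠ xs ∙ cs) ≟ B +ᶠ (y *ᶠ c +ᶠ xs ∙ cs))
           𝔽-unique (affine-agreement-unique (λ x≡y → x≢y (cong (_∷ xs) x≡y)))) ⟩
    (∑[ cs ← vectors d ] 1)
      ≡⟨ ∑-vectors-const d 1 ⟩
    q ^ d * 1
      ≡⟨ *-identityʳ _ ⟩
    q ^ d ∎
  affine-agreements zero {x ∷ []} {y ∷ []} x≢y A B | no xs≢ys = contradiction refl xs≢ys
  affine-agreements (suc d) {x ∷ xs} {y ∷ ys} x≢y A B | no xs≢ys = begin
    (∑[ f ← vectors (suc (suc d)) ] ⟦ A +ᶠ (x ∷ xs) ∙ f ≟ B +ᶠ (y ∷ ys) ∙ f ⟧)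
      ≡⟨ ∑-vectors (suc d) _ ⟩
    (∑[ c ← 𝔽 ] ∑[ cs ← vectors (suc d) ] ⟦ A +ᶠ (x *ᶠ c +ᶠ xs ∙ cs) ≟ B +ᶠ (y *ᶠ c +ᶠ ys ∙ cs) ⟧)
      -- For fixed `c`, reassociation moves `x *ᶠ c` and `y *ᶠ c` into the offsets, and the
      -- induction hypothesis applies to the tails.
      ≤⟨ ∑-mono 𝔽 (λ {c} _ → ≤-trans
           (∑-mono (vectors (suc d)) (λ {cs} _ → ⟦⟧-mono (_ ≟ _) (_ ≟ _) (λ eq →
             trans (+ᶠ-assoc A (x *ᶠ c) (xs ∙ cs)) (trans eq (sym (+ᶠ-assoc B (y *ᶠ c) (ys ∙ cs)))))))
           (affine-agreements d xs≢ys (A +ᶠ x *ᶠ c) (B +ᶠ y *ᶠ c))) ⟩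
    (∑[ c ← 𝔽 ] q ^ d)
      ≡⟨ ∑𝔽-const (q ^ d) ⟩
    q ^ suc d ∎

  -- One bound for both cases, ready to be summed over pairs: a diagonal pair agrees on the whole
  -- space, any other pair on at most a hyperplane. The term `q ^ d` is slack on the diagonal.
  agreements : ∀ d (x y : V (suc d)) →
    (∑[ f ← vectors (suc d) ] ⟦ x ∙ f ≟ y ∙ f ⟧) ≤ ⟦ x ≟ᵛ y ⟧ * q ^ suc d + q ^ d
  agreements d x y with x ≟ᵛ y
  ... | yes _ = begin
    (∑[ f ← vectors (suc d) ] ⟦ x ∙ f ≟ y ∙ f ⟧)
      -- The bracket of the true equation `x ≡ x`, decided by `yes refl`, supplies the constant 1.
      ≤⟨ ∑-mono (vectors (suc d)) (λ {f} _ → ⟦⟧-mono (x ∙ f ≟ y ∙ f) (yes refl) (λ _ → refl {x = x})) ⟩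
    (∑[ f ← vectors (suc d) ] 1)
      ≡⟨ ∑-vectors-const (suc d) 1 ⟩
    q ^ suc d * 1
      ≡⟨ *-comm (q ^ suc d) 1 ⟩
    1 * q ^ suc d
      ≤⟨ m≤m+n _ _ ⟩
    1 * q ^ suc d + q ^ d ∎
  ... | no x≢y = ≤-trans
    (∑-mono (vectors (suc d)) (λ {f} _ → ⟦⟧-mono (x ∙ f ≟ y ∙ f) (_ ≟ _) (cong (0# +ᶠ_))))
    (affine-agreements d x≢y 0# 0#)

  -- The incidence counts N f s and their second moment over all `f`.

  incidences : ∀ {d} → List (V d) → V d → Carrier → ℕ
  incidences E f s = ∑[ x ← E ] ⟦ x ∙ f ≟ s ⟧

  -- Every point lies on some level of `f`. This bounds the linear term of `second-moment-bound`
  -- from below.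
  length≤∑-incidences : ∀ {d} (E : List (V d)) f → length E ≤ ∑ 𝔽 (incidences E f)
  length≤∑-incidences E f = begin
    length E                                  ≡⟨ *-identityʳ _ ⟨
    length E * 1                              ≡⟨ ∑-const E 1 ⟨
    (∑[ x ← E ] 1)                            ≤⟨ ∑-mono E (λ {x} _ → 1≤∑-≡ (x ∙ f)) ⟩
    (∑[ x ← E ] ∑[ s ← 𝔽 ] ⟦ x ∙ f ≟ s ⟧)     ≡⟨ ∑-swap E 𝔽 _ ⟩
    ∑ 𝔽 (incidences E f)                      ∎

  -- Both sides count triples (f, x, y) with x ∙ f = y ∙ f: a square counts pairs on one level, and
  -- exchanging the sums fixes the pair first, so that `agreements` applies.
  ∑-incidences² : ∀ d {E : List (V (suc d))} → Unique E →
    (∑[ f ← vectors (suc d) ] ∑[ s ← 𝔽 ] incidences E f s * incidences E f s) ≤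
    length E * (q ^ suc d + length E * q ^ d)
  ∑-incidences² d {E} E! = begin
    (∑[ f ← vectors (suc d) ] ∑[ s ← 𝔽 ] incidences E f s * incidences E f s)
      ≤⟨ ∑-mono (vectors (suc d)) (λ {f} _ → begin
        (∑[ s ← 𝔽 ] incidences E f s * incidences E f s)
          ≡⟨ ∑-cong 𝔽 (λ s → ∑-*-∑ E E _ _) ⟩
        (∑[ s ← 𝔽 ] ∑[ x ← E ] ∑[ y ← E ] ⟦ x ∙ f ≟ s ⟧ * ⟦ y ∙ f ≟ s ⟧)
          ≡⟨ ∑-swap 𝔽 E _ ⟩
        (∑[ x ← E ] ∑[ s ← 𝔽 ] ∑[ y ← E ] ⟦ x ∙ f ≟ s ⟧ * ⟦ y ∙ f ≟ s ⟧)
          ≡⟨ ∑-cong E (λ x → ∑-swap 𝔽 E _) ⟩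
        (∑[ x ← E ] ∑[ y ← E ] ∑[ s ← 𝔽 ] ⟦ x ∙ f ≟ s ⟧ * ⟦ y ∙ f ≟ s ⟧)
          ≤⟨ ∑-mono E (λ {x} _ → ∑-mono E (λ {y} _ → ∑-common (x ∙ f) (y ∙ f))) ⟩
        (∑[ x ← E ] ∑[ y ← E ] ⟦ x ∙ f ≟ y ∙ f ⟧) ∎) ⟩
    (∑[ f ← vectors (suc d) ] ∑[ x ← E ] ∑[ y ← E ] ⟦ x ∙ f ≟ y ∙ f ⟧)
      ≡⟨ ∑-swap (vectors (suc d)) E _ ⟩
    (∑[ x ← E ] ∑[ f ← vectors (suc d) ] ∑[ y ← E ] ⟦ x ∙ f ≟ y ∙ f ⟧)
      ≡⟨ ∑-cong E (λ x → ∑-swap (vectors (suc d)) E _) ⟩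
    (∑[ x ← E ] ∑[ y ← E ] ∑[ f ← vectors (suc d) ] ⟦ x ∙ f ≟ y ∙ f ⟧)
      ≤⟨ ∑-mono E (λ {x} _ → ∑-mono E (λ {y} _ → agreements d x y)) ⟩
    (∑[ x ← E ] ∑[ y ← E ] ⟦ x ≟ᵛ y ⟧ * q ^ suc d + q ^ d)
      ≤⟨ ∑-mono E (λ {x} _ → begin
        (∑[ y ← E ] ⟦ x ≟ᵛ y ⟧ * q ^ suc d + q ^ d)
          ≡⟨ ∑-+ E _ _ ⟩
        (∑[ y ← E ] ⟦ x ≟ᵛ y ⟧ * q ^ suc d) + (∑[ y ← E ] q ^ d)
          ≡⟨ cong₂ _+_ (∑-*ʳ E _ _) (∑-const E _) ⟩
        (∑[ y ← E ] ⟦ x ≟ᵛ y ⟧) * q ^ suc d + length E * q ^ d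
          -- As `E` has no duplicates, `x` meets the diagonal at most once.
          ≤⟨ +-monoˡ-≤ _ (*-monoˡ-≤ (q ^ suc d) (count≤1 (x ≟ᵛ_) E! (λ x≡y x≡z → trans (sym x≡y) x≡z))) ⟩
        1 * q ^ suc d + length E * q ^ d
          ≡⟨ cong (_+ length E * q ^ d) (*-identityˡ _) ⟩
        q ^ suc d + length E * q ^ d ∎) ⟩
    (∑[ x ← E ] q ^ suc d + length E * q ^ d)
      ≡⟨ ∑-const E _ ⟩
    length E * (q ^ suc d + length E * q ^ d) ∎

  -- Two finite searches in `E` among the points orthogonal to `f`: first for a nonzero `y`, then
  -- for a `z` not parallel to it. A failed second search puts all these points on the line of `y`.
  orthogonal-pair-or-line : ∀ E f →
    (∃ λ y → ∃ λ z → y ∈ E × z ∈ E × y ∙ f ≡ 0# × z ∙ f ≡ 0# × cross y z ≢ 0ᵛ) ⊎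
    (∃ λ y → ∀ {z} → z ∈ E → z ∙ f ≡ 0# → ∃ λ c → z ≡ c ·ᵛ y)
  orthogonal-pair-or-line E f with any? (λ y → (y ∙ f ≟ 0#) ×-dec ¬? (y ≟ᵛ 0ᵛ)) E
  -- Only the zero vector can occur here, so the line degenerates to the multiples of `0ᵛ`.
  ... | no all-zero = inj₂ (0ᵛ , λ {z} z∈E zf≡0 → 0# ,
    trans (decidable-stable (z ≟ᵛ 0ᵛ) (λ z≢0 → all-zero (lose z∈E (zf≡0 , z≢0)))) (sym (0·ᵛ 0ᵛ)))
  ... | yes some-y with y , y∈E , yf≡0 , y≢0 ← find some-y
                   with any? (λ z → (z ∙ f ≟ 0#) ×-dec ¬? (cross y z ≟ᵛ 0ᵛ)) E
  ...   | yes some-z with z , z∈E , zf≡0 , y×z≢0 ← find some-z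
        = inj₁ (y , z , y∈E , z∈E , yf≡0 , zf≡0 , y×z≢0)
  ...   | no all-parallel = inj₂ (y , λ {z} z∈E zf≡0 → parallel⇒multiple y≢0 (cross≡0⇒parallel y z
    (decidable-stable (cross y z ≟ᵛ 0ᵛ) (λ y×z≢0 → all-parallel (lose z∈E (zf≡0 , y×z≢0))))))

  -- The line is parametrised by `q` scalars, and each multiple of `y` occurs at most once in `E`.
  count-on-line≤q : ∀ {d} {E : List (V d)} → Unique E → ∀ f y →
    (∀ {z} → z ∈ E → z ∙ f ≡ 0# → ∃ λ c → z ≡ c ·ᵛ y) → incidences E f 0# ≤ q
  count-on-line≤q {E = E} E! f y on-line = begin
    (∑[ z ← E ] ⟦ z ∙ f ≟ 0# ⟧)                ≤⟨ ∑-mono E pointwise ⟩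
    (∑[ z ← E ] ∑[ c ← 𝔽 ] ⟦ z ≟ᵛ c ·ᵛ y ⟧)    ≡⟨ ∑-swap E 𝔽 _ ⟩
    (∑[ c ← 𝔽 ] ∑[ z ← E ] ⟦ z ≟ᵛ c ·ᵛ y ⟧)    ≤⟨ ∑-mono 𝔽 (λ {c} _ → count≤1 (_≟ᵛ c ·ᵛ y) E! (λ eq eq′ → trans eq (sym eq′))) ⟩
    (∑[ c ← 𝔽 ] 1)                             ≡⟨ ∑𝔽-const 1 ⟩
    q * 1                                      ≡⟨ *-identityʳ q ⟩
    q                                          ∎
    where
    pointwise : ∀ {z} → z ∈ E → ⟦ z ∙ f ≟ 0# ⟧ ≤ (∑[ c ← 𝔽 ] ⟦ z ≟ᵛ c ·ᵛ y ⟧)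
    pointwise {z} z∈E with z ∙ f ≟ 0#
    ... | no _ = z≤n
    ... | yes zf≡0 with c , z≡cy ← on-line z∈E zf≡0 =
      ≤-trans (⟦⟧-yes (z ≟ᵛ c ·ᵛ y) z≡cy) (term≤∑ (λ c → ⟦ z ≟ᵛ c ·ᵛ y ⟧) (∈-𝔽 c))

  incidences≤0 : ∀ {d} (E : List (V d)) f s → (∀ {x} → x ∈ E → x ∙ f ≢ s) → incidences E f s ≤ 0
  incidences≤0 E f s = count≤0 (λ x → x ∙ f ≟ s) E

  -- The common threshold `q` comes from the collinear case; the other cases give an empty level,
  -- and 0 is weakened to `q`.
  missing-volume⇒poor-level : ∀ {E} → Unique E → ∀ {t} →
    (∀ {x y z} → x ∈ E → y ∈ E → z ∈ E → vol x y z ≢ t) → ∀ f → ∃ λ s → incidences E f s ≤ q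
  missing-volume⇒poor-level {E} E! t-missing f with f ≟ᵛ 0ᵛ | orthogonal-pair-or-line E f
  -- All dot products with the zero vector are `0#`, so the level `1#` is empty.
  ... | yes f≡0 | _ = 1# , ≤-trans
    (incidences≤0 E f 1# (λ {x} _ xf≡1 → 1≢0 (trans (sym xf≡1) (trans (cong (x ∙_) f≡0) (∙-zeroʳ x))))) z≤n
  ... | no f≢0  | inj₂ (y , on-line) = 0# , count-on-line≤q E! f y on-line
  ... | no f≢0  | inj₁ (y , z , y∈E , z∈E , yf≡0 , zf≡0 , y×z≢0) =
    let s , s-missing = missing-volume⇒empty-level t-missing f≢0 y∈E z∈E yf≡0 zf≡0 y×z≢0
    in s , ≤-trans (incidences≤0 E f s s-missing) z≤n

  every-volume-occurs : ∀ {E} → Unique E → length E ≡ 3 * q ^ 2 → ∀ {t} →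
    ¬ (∀ {x y z} → x ∈ E → y ∈ E → z ∈ E → vol x y z ≢ t)
  every-volume-occurs {E} E! |E|≡3q² t-missing =
    contradiction (+-cancelˡ-≤ K (q ^ 5) 0 excess) (<⇒≱ (m^n>0 q {{>-nonZero 1≤q}} 5))
    where
    ∑N² : V 3 → ℕ
    ∑N² f = ∑[ s ← 𝔽 ] incidences E f s * incidences E f s

    -- The variance inequality about the mean `3 * q` of 3q² points over `q` levels, retaining only
    -- the squared deviation of the poor level.
    per-direction : ∀ f → 2 * (3 * q) * (3 * q ^ 2) + 2 * q * (2 * q) ≤ ∑N² f + q * (3 * q * (3 * q))
    per-direction f = begin
      2 * (3 * q) * (3 * q ^ 2) + 2 * q * (2 * q)
        ≡⟨ cong (λ n → 2 * (3 * q) * n + 2 * q * (2 * q)) |E|≡3q² ⟨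
      2 * (3 * q) * length E + 2 * q * (2 * q)
        ≤⟨ +-monoˡ-≤ (2 * q * (2 * q)) (*-monoʳ-≤ (2 * (3 * q)) (length≤∑-incidences E f)) ⟩
      2 * (3 * q) * ∑ 𝔽 (incidences E f) + 2 * q * (2 * q)
        ≤⟨ second-moment-bound 𝔽 (incidences E f) (3 * q) (2 * q) (∈-𝔽 s) deviation ⟩
      ∑N² f + length 𝔽 * (3 * q * (3 * q))
        ≡⟨ cong (λ n → ∑N² f + n * (3 * q * (3 * q))) length-𝔽 ⟩
      ∑N² f + q * (3 * q * (3 * q)) ∎
      where
      poor-level : ∃ λ s → incidences E f s ≤ q
      poor-level = missing-volume⇒poor-level E! t-missing f
      s = proj₁ poor-level
      deviation : 2 * q ≤ ∣ incidences E f s - 3 * q ∣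
      deviation = begin
        2 * q                            ≤⟨ m+n≤o⇒m≤o∸n (2 * q) (≤-trans (+-monoʳ-≤ (2 * q) (proj₂ poor-level)) (≤-reflexive (+-comm (2 * q) q))) ⟩
        3 * q ∸ incidences E f s         ≡⟨ m≤n⇒∣m-n∣≡n∸m (≤-trans (proj₂ poor-level) (m≤n*m q 3)) ⟨
        ∣ incidences E f s - 3 * q ∣     ∎

    -- The upper bound 18q⁶ + 3q⁵: the second moment from `∑-incidences²` at |E| = 3q², plus q³
    -- copies of the constant term q(3q)².
    K : ℕ
    K = 3 * q ^ 2 * (q ^ 3 + 3 * q ^ 2 * q ^ 2) + q ^ 3 * (q * (3 * q * (3 * q)))

    excess : K + q ^ 5 ≤ K + 0
    excess = begin
      K + q ^ 5
        -- The lower bound summed over the q³ vectors is 18q⁶ + 4q⁵, which exceeds `K` by q⁵.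
        -- Writing the final bound as `K + 0` lets `K` cancel, leaving q⁵ ≤ 0.
        ≡⟨ solve 1 (λ q → con 3 :* q :^ 2 :* (q :^ 3 :+ con 3 :* q :^ 2 :* q :^ 2)
             :+ q :^ 3 :* (q :* (con 3 :* q :* (con 3 :* q))) :+ q :^ 5 :=
             q :^ 3 :* (con 2 :* (con 3 :* q) :* (con 3 :* q :^ 2) :+ con 2 :* q :* (con 2 :* q))) refl q ⟩
      q ^ 3 * (2 * (3 * q) * (3 * q ^ 2) + 2 * q * (2 * q))
        ≡⟨ ∑-vectors-const 3 _ ⟨
      (∑[ f ← vectors 3 ] 2 * (3 * q) * (3 * q ^ 2) + 2 * q * (2 * q))
        ≤⟨ ∑-mono (vectors 3) (λ {f} _ → per-direction f) ⟩
      (∑[ f ← vectors 3 ] ∑N² f + q * (3 * q * (3 * q)))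
        ≡⟨ ∑-+ (vectors 3) ∑N² _ ⟩
      ∑ (vectors 3) ∑N² + (∑[ f ← vectors 3 ] q * (3 * q * (3 * q)))
        ≡⟨ cong (∑ (vectors 3) ∑N² +_) (∑-vectors-const 3 _) ⟩
      ∑ (vectors 3) ∑N² + q ^ 3 * (q * (3 * q * (3 * q)))
        ≤⟨ +-monoˡ-≤ _ (∑-incidences² 2 E!) ⟩
      length E * (q ^ 3 + length E * q ^ 2) + q ^ 3 * (q * (3 * q * (3 * q)))
        ≡⟨ cong (λ n → n * (q ^ 3 + n * q ^ 2) + q ^ 3 * (q * (3 * q * (3 * q)))) |E|≡3q² ⟩
      K
        ≡⟨ +-identityʳ K ⟨
      K + 0 ∎

  -- Cutting `E` down to exactly 3q² points makes the mean exactly 3q, and volumes of the shorter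
  -- list are still volumes of `E`. Decidable membership turns the refutation into a proof.
  volSet-exhaustive : ∀ {E} → Unique E → 3 * q ^ 2 ≤ length E → ∀ t → t ∈ volSet E
  volSet-exhaustive {E} E! 3q²≤|E| t = decidable-stable (t ∈? volSet E) λ t∉ →
    every-volume-occurs (take⁺ (3 * q ^ 2) E!)
      (trans (length-take (3 * q ^ 2) E) (m≤n⇒m⊓n≡m 3q²≤|E|))
      (λ x∈ y∈ z∈ eq → t∉ (subst (_∈ volSet E) eq (vol∈volSet (⊆E x∈) (⊆E y∈) (⊆E z∈))))
    where
    open DecMembership _≟_ using (_∈?_)
    ⊆E : ∀ {x} → x ∈ take (3 * q ^ 2) E → x ∈ E
    ⊆E = Sublist.lookup (take-⊆ (3 * q ^ 2) E)
    vol∈volSet : ∀ {x y z} → x ∈ E → y ∈ E → z ∈ E → vol x y z ∈ volSet E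
    vol∈volSet x∈ y∈ z∈ = ∈-deduplicate⁺ _≟_
      (∈-cartesianProductWith⁺ (λ x (y , z) → vol x y z) x∈ (∈-cartesianProduct⁺ y∈ z∈))

  -- Double counting of equal pairs (t, v): each field element matches some entry of `volSet E`, and
  -- each entry matches at most one field element.
  q≤|volSet| : ∀ {E} → Unique E → 3 * q ^ 2 ≤ length E → q ≤ length (volSet E)
  q≤|volSet| {E} E! 3q²≤|E| = begin
    q                                                  ≡⟨ *-identityʳ q ⟨
    q * 1                                              ≡⟨ ∑𝔽-const 1 ⟨
    (∑[ t ← 𝔽 ] 1)                                     ≤⟨ ∑-mono 𝔽 (λ {t} _ → ≤-trans (⟦⟧-yes (t ≟ t) refl)
                                                          (term≤∑ (λ v → ⟦ v ≟ t ⟧) (volSet-exhaustive E! 3q²≤|E| t))) ⟩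
    (∑[ t ← 𝔽 ] ∑[ v ← volSet E ] ⟦ v ≟ t ⟧)           ≡⟨ ∑-swap 𝔽 (volSet E) _ ⟩
    (∑[ v ← volSet E ] ∑[ t ← 𝔽 ] ⟦ v ≟ t ⟧)           ≤⟨ ∑-mono (volSet E) (λ {v} _ → ∑-≡≤1 v) ⟩
    (∑[ v ← volSet E ] 1)                              ≡⟨ ∑-const (volSet E) 1 ⟩
    length (volSet E) * 1                              ≡⟨ *-identityʳ _ ⟩
    length (volSet E)                                  ∎

-- The embedding of ℕ in ℚ preserves and reflects order and respects products.

module Rationals where
  open import Data.Integer.Base as ℤ using (+_)
  import Data.Integer.Properties as ℤ
  open import Data.Nat.Base as ℕ using (ℕ)
  open import Data.Rational.Base using (_≤_; _*_; toℚᵘ)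
  open import Data.Rational.Properties using (toℚᵘ-mono-≤; toℚᵘ-cancel-≤; toℚᵘ-fromℚᵘ; toℚᵘ-homo-*; toℚᵘ-injective)
  open import Data.Rational.Unnormalised.Base as ℚᵘ using (mkℚᵘ; *≤*)
  import Data.Rational.Unnormalised.Properties as ℚᵘ
  open import Relation.Binary.PropositionalEquality

  -- The gcd normalisation in `_/_` hides the numerator, so comparisons are made among unnormalised
  -- rationals; the `0` in `mkℚᵘ (+ n) 0` encodes the denominator 1.
  toℚᵘ-fromℕ : ∀ n → toℚᵘ (fromℕ n) ℚᵘ.≃ mkℚᵘ (+ n) 0
  toℚᵘ-fromℕ n = toℚᵘ-fromℚᵘ (mkℚᵘ (+ n) 0)

  fromℕ-mono-≤ : ∀ {m n} → m ℕ.≤ n → fromℕ m ≤ fromℕ n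
  fromℕ-mono-≤ {m} {n} m≤n = toℚᵘ-cancel-≤ (begin
    toℚᵘ (fromℕ m)   ≃⟨ toℚᵘ-fromℕ m ⟩
    mkℚᵘ (+ m) 0     ≤⟨ *≤* (ℤ.*-monoʳ-≤-nonNeg (+ 1) (ℤ.+≤+ m≤n)) ⟩
    mkℚᵘ (+ n) 0     ≃⟨ toℚᵘ-fromℕ n ⟨
    toℚᵘ (fromℕ n)   ∎)
    where open ℚᵘ.≤-Reasoning

  fromℕ-cancel-≤ : ∀ {m n} → fromℕ m ≤ fromℕ n → m ℕ.≤ n
  fromℕ-cancel-≤ {m} {n} m≤n = ℤ.drop‿+≤+ (ℤ.*-cancelʳ-≤-pos (+ m) (+ n) (+ 1) (ℚᵘ.drop-*≤* (begin
    mkℚᵘ (+ m) 0     ≃⟨ toℚᵘ-fromℕ m ⟨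
    toℚᵘ (fromℕ m)   ≤⟨ toℚᵘ-mono-≤ m≤n ⟩
    toℚᵘ (fromℕ n)   ≃⟨ toℚᵘ-fromℕ n ⟩
    mkℚᵘ (+ n) 0     ∎)))
    where open ℚᵘ.≤-Reasoning

  fromℕ-* : ∀ m n → fromℕ (m ℕ.* n) ≡ fromℕ m * fromℕ n
  fromℕ-* m n = toℚᵘ-injective (begin
    toℚᵘ (fromℕ (m ℕ.* n))              ≈⟨ toℚᵘ-fromℕ (m ℕ.* n) ⟩
    mkℚᵘ (+ (m ℕ.* n)) 0                ≡⟨ cong (λ i → mkℚᵘ i 0) (ℤ.pos-* m n) ⟩
    mkℚᵘ (+ m) 0 ℚᵘ.* mkℚᵘ (+ n) 0      ≈⟨ ℚᵘ.*-cong (toℚᵘ-fromℕ m) (toℚᵘ-fromℕ n) ⟨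
    toℚᵘ (fromℕ m) ℚᵘ.* toℚᵘ (fromℕ n)  ≈⟨ toℚᵘ-homo-* (fromℕ m) (fromℕ n) ⟨
    toℚᵘ (fromℕ m * fromℕ n)            ∎)
    where open import Relation.Binary.Reasoning.Setoid ℚᵘ.≃-setoid

-- The rational form of the bound.

open import Data.List.Base using (List; length)
open import Data.List.Relation.Unary.Unique.Propositional using (Unique)
open import Data.Nat.Base using (_^_)
open import Data.Product.Base using (Σ; _×_; _,_)
open import Data.Rational.Base using (ℚ; 0ℚ; _<_; _≤_; _*_)
open import Data.Rational.Properties using (positive⁻¹; *-identityˡ)
open import Relation.Binary.PropositionalEquality using (subst; sym)
open FiniteField using (order)
open LinearAlgebra using (V; InGeneralPosition; volSet)
open Rationals

theorem2p10 : {a : Level} →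
    Σ ℚ λ C → Σ ℚ λ c → 0ℚ < C × 0ℚ < c ×
    ((F : FiniteField a) (E : List (V F 3)) →
    Unique E → InGeneralPosition F E →
    C * fromℕ (order F ^ 2) ≤ fromℕ (length E) →
    c * fromℕ (order F) ≤ fromℕ (length (volSet F E)))
theorem2p10 = fromℕ 3 , fromℕ 1 , positive⁻¹ (fromℕ 3) , positive⁻¹ (fromℕ 1) ,
  -- The size hypothesis is pulled back to ℕ, and the bound on `volSet` is pushed forward to ℚ,
  -- where the factor 1 is absorbed.
  λ F E E! _ 3q²≤|E| → subst (_≤ fromℕ (length (volSet F E))) (sym (*-identityˡ (fromℕ (order F))))
    (fromℕ-mono-≤ (Counting.q≤|volSet| F E!
      (fromℕ-cancel-≤ (subst (_≤ fromℕ (length E)) (sym (fromℕ-* 3 (order F ^ 2))) 3q²≤|E|))))
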